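{- For every $k\ge1$ and all $\bm{I}_1,\bm{I}_2,\bm{I}_3,\bm{J}_1,\bm{J}_2,\bm{J}_3\in\{0,1\}^k$, \[\sum_{\bm{K}_1,\bm{K}_2,\bm{K}_3\in\{0,1\}^k}L_y(\bm{K}_3,\bm{K}_2;\bm{J}_3,\bm{J}_2)\,L_x(\bm{I}_3,\bm{K}_1;\bm{K}_3,\bm{J}_1)\,R_{y/x}(\bm{I}_2,\bm{I}_1;\bm{K}_2,\bm{K}_1)=\sum_{\bm{L}_1,\bm{L}_2,\bm{L}_3\in\{0,1\}^k}R_{y/x}(\bm{L}_2,\bm{L}_1;\bm{J}_2,\bm{J}_1)\,L_x(\bm{L}_3,\bm{I}_1;\bm{J}_3,\bm{L}_1)\,L_y(\bm{I}_3,\bm{I}_2;\bm{L}_3,\bm{L}_2).\]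
   Context: For $\bm{I}\in\{0,1\}^k$ write $|\bm{I}|=\sum_m I_m$ and $\bm{I}_{[i,j]}=\sum_{m=i}^j I_m$ (empty sum $0$). The $L$-weights: $L_x(\bm{I},\bm{J};\bm{K},\bm{L})=x^{|\bm{L}|}\prod_{m:L_m=1}t^{\bm{I}_{[m+1,k]}+\bm{J}_{[m+1,k]}}$ if $\bm{I}+\bm{J}=\bm{K}+\bm{L}$ and there is no $i$ with $I_i=J_i=1$, and $0$ otherwise. The $R$-weights, for a parameter $z$ (here $z=y/x$): $R_z(\bm{I},\bm{J};\bm{K},\bm{L})=\prod_{i=1}^k\left(z t^{ -\delta_i}\right)^{K_i}\left(1-z t^{ -\delta_i}\right)^{(J_i-I_i+L_i-K_i)/2}$ with $\delta_i=\tfrac12\left(\bm{J}_{[i+1,k]}-\bm{I}_{[i+1,k]}+\bm{L}_{[i+1,k]}-\bm{K}_{[i+1,k]}\right)$, whenever $\bm{I}+\bm{J}=\bm{K}+\bm{L}$ and there is no $i$ with $I_i=K_i=1$ and $J_i=L_i=0$; otherwise $R_z(\bm{I},\bm{J};\bm{K},\bm{L})=0$. -}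

module Defs where

open import Algebra.Bundles using (CommutativeRing)
open import Data.Bool using (Bool; true; false; _∧_; not; if_then_else_)
open import Data.Nat as ℕ using (ℕ; zero; suc; _≡ᵇ_; ⌊_/2⌋; ⌈_/2⌉)
open import Data.Integer as ℤ using (ℤ; +_; -[1+_])
open import Data.Vec using (Vec; []; _∷_)
open import Data.List using (List; []; _∷_; map; _++_; foldr)

b2n : Bool → ℕ
b2n false = 0
b2n true  = 1

b2z : Bool → ℤ
b2z b = + b2n b

∣_∣ᵥ : ∀ {k} → Vec Bool k → ℕ
∣ [] ∣ᵥ    = 0
∣ b ∷ v ∣ᵥ = b2n b ℕ.+ ∣ v ∣ᵥ

allVecs : (k : ℕ) → List (Vec Bool k)
allVecs zero    = [] ∷ []
allVecs (suc k) = map (false ∷_) (allVecs k) ++ map (true ∷_) (allVecs k)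

-- n/2 on integers (floor); only ever applied to even integers on the support
halfℤ : ℤ → ℤ
halfℤ (+ n)      = + ⌊ n /2⌋
halfℤ -[1+ n ]   = ℤ.- (+ ⌈ suc n /2⌉)

-- natural part of an integer exponent (negatives never occur on the support)
ℤ⁺ : ℤ → ℕ
ℤ⁺ (+ n)    = n
ℤ⁺ -[1+ _ ] = 0

condL : ∀ {k} → Vec Bool k → Vec Bool k → Vec Bool k → Vec Bool k → Bool
condL [] [] [] [] = true
condL (i ∷ I) (j ∷ J) (a ∷ K) (l ∷ L) =
  ((b2n i ℕ.+ b2n j) ≡ᵇ (b2n a ℕ.+ b2n l)) ∧ not (i ∧ j) ∧ condL I J K L

condR : ∀ {k} → Vec Bool k → Vec Bool k → Vec Bool k → Vec Bool k → Bool
condR [] [] [] [] = true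
condR (i ∷ I) (j ∷ J) (a ∷ K) (l ∷ L) =
  ((b2n i ℕ.+ b2n j) ≡ᵇ (b2n a ℕ.+ b2n l))
  ∧ not (i ∧ a ∧ not j ∧ not l) ∧ condR I J K L

module Weights {c ℓ} (𝓡 : CommutativeRing c ℓ) (t tinv : CommutativeRing.Carrier 𝓡) where
  open CommutativeRing 𝓡

  infixr 8 _^ₙ_
  _^ₙ_ : Carrier → ℕ → Carrier
  a ^ₙ zero  = 1#
  a ^ₙ suc n = a * (a ^ₙ n)

  tpow : ℤ → Carrier
  tpow (+ n)    = t ^ₙ n
  tpow -[1+ n ] = tinv ^ₙ suc n

  Σ : ∀ {a} {A : Set a} → List A → (A → Carrier) → Carrier
  Σ xs f = foldr (λ v acc → f v + acc) 0# xs

  -- Π_m x^{L_m} t^{L_m (I_[m+1,k] + J_[m+1,k])}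
  -- (the tail of the vectors after position m is exactly positions m+1..k)
  Lprod : Carrier → ∀ {k} → Vec Bool k → Vec Bool k → Vec Bool k → Vec Bool k → Carrier
  Lprod x [] [] [] [] = 1#
  Lprod x (i ∷ I) (j ∷ J) (a ∷ K) (l ∷ L) =
    (if l then x * tpow (+ (∣ I ∣ᵥ ℕ.+ ∣ J ∣ᵥ)) else 1#) * Lprod x I J K L

  Lw : Carrier → ∀ {k} → Vec Bool k → Vec Bool k → Vec Bool k → Vec Bool k → Carrier
  Lw x I J K L = if condL I J K L then Lprod x I J K L else 0#

  -- 2δ_i = J_[i+1,k] - I_[i+1,k] + L_[i+1,k] - K_[i+1,k]  (computed on the tails)
  twoδ : ∀ {k} → Vec Bool k → Vec Bool k → Vec Bool k → Vec Bool k → ℤ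
  twoδ I J K L = (+ ∣ J ∣ᵥ ℤ.- + ∣ I ∣ᵥ) ℤ.+ (+ ∣ L ∣ᵥ ℤ.- + ∣ K ∣ᵥ)

  Rprod : Carrier → ∀ {k} → Vec Bool k → Vec Bool k → Vec Bool k → Vec Bool k → Carrier
  Rprod z [] [] [] [] = 1#
  Rprod z (i ∷ I) (j ∷ J) (a ∷ K) (l ∷ L) =
    let δ = halfℤ (twoδ I J K L)
        w = z * tpow (ℤ.- δ)
        e = halfℤ ((b2z j ℤ.- b2z i) ℤ.+ (b2z l ℤ.- b2z a))
    in ((w ^ₙ b2n a) * ((1# - w) ^ₙ ℤ⁺ e)) * Rprod z I J K L

  Rw : Carrier → ∀ {k} → Vec Bool k → Vec Bool k → Vec Bool k → Vec Bool k → Carrier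
  Rw z I J K L = if condR I J K L then Rprod z I J K L else 0#

  Σ³ : (k : ℕ) → (Vec Bool k → Vec Bool k → Vec Bool k → Carrier) → Carrier
  Σ³ k f = Σ (allVecs k) λ A → Σ (allVecs k) λ B → Σ (allVecs k) λ C → f A B C

{-# OPTIONS --safe #-}
-- Replace the constant 1 in the sums by the polynomials
--   P n e f = ∏_{j<n} (x t^(j+e) − y t^f),
-- with e = |I₃| + |K₁|, f = |I₂| + |I₃| on the left and e = |J₃| + |L₁|,
-- f = |J₂| + |J₃| on the right.  Given the other columns, summing over the
-- first column turns P n into α P n + β P (n+1) with the same α and β on both
-- sides, so the identity for all n follows by induction on the number of
-- columns; n = 0 is the theorem.
module Submission where

open import Defs
open import Algebra.Bundles using (CommutativeRing)
open import Data.Bool using (Bool; true; false; _∧_; not; if_then_else_; T)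
import Data.Bool.Properties as Bool
open import Data.Integer as ℤ using (ℤ; +_; -[1+_]; _⊖_)
import Data.Integer.Properties as ℤ
open import Data.List using (List; []; _∷_; map; _++_; foldr; filterᵇ; replicate)
import Data.List.Properties as List
open import Data.Nat as ℕ using (ℕ; zero; suc; _≤_; _≡ᵇ_)
import Data.Nat.Properties as ℕ
open import Data.Product using (_×_; _,_; ∃₂)
open import Data.Sum using (_⊎_; inj₁; inj₂)
open import Data.Unit using (tt)
open import Data.Vec using (Vec; []; _∷_)
import Data.Vec.Properties as Vec
open import Function using (_∘_)
open import Level using (_⊔_)
open import Relation.Binary.PropositionalEquality as ≡ using (_≡_; cong; cong₂; subst)
open import Relation.Nullary.Decidable using (Dec; map′; toWitness; _×-dec_; _⊎-dec_)
import Algebra.Properties.CommutativeSemigroup as CommutativeSemigroup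
import Algebra.Properties.AbelianGroup as AbelianGroup
import Algebra.Properties.Ring as Ring
import Algebra.Solver.Ring.NaturalCoefficients.Default as SemiringSolver

open CommutativeSemigroup ℕ.+-commutativeSemigroup using () renaming (interchange to +-interchange)

-- Conservation of the number of ones.

∧-trueˡ : ∀ {a b} → a ∧ b ≡ true → a ≡ true
∧-trueˡ {true} _ = ≡.refl

∧-trueʳ : ∀ {a b} → a ∧ b ≡ true → b ≡ true
∧-trueʳ {true} eq = eq

≡ᵇ-true : ∀ {m n} → (m ≡ᵇ n) ≡ true → m ≡ n
≡ᵇ-true {m} {n} eq = ℕ.≡ᵇ⇒≡ m n (subst T (≡.sym eq) tt)

∣∷∣-+ : ∀ {k} a b (A B : Vec Bool k) →
  ∣ a ∷ A ∣ᵥ ℕ.+ ∣ b ∷ B ∣ᵥ ≡ (b2n a ℕ.+ b2n b) ℕ.+ (∣ A ∣ᵥ ℕ.+ ∣ B ∣ᵥ)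
∣∷∣-+ a b A B = +-interchange (b2n a) ∣ A ∣ᵥ (b2n b) ∣ B ∣ᵥ

∣∣-conserved : ∀ {k} i j a l (I J K L : Vec Bool k) → (b2n i ℕ.+ b2n j ≡ᵇ b2n a ℕ.+ b2n l) ≡ true →
  ∣ I ∣ᵥ ℕ.+ ∣ J ∣ᵥ ≡ ∣ K ∣ᵥ ℕ.+ ∣ L ∣ᵥ →
  ∣ i ∷ I ∣ᵥ ℕ.+ ∣ j ∷ J ∣ᵥ ≡ ∣ a ∷ K ∣ᵥ ℕ.+ ∣ l ∷ L ∣ᵥ
∣∣-conserved i j a l I J K L head tail = ≡.trans (∣∷∣-+ i j I J)
  (≡.trans (cong₂ ℕ._+_ (≡ᵇ-true {b2n i ℕ.+ b2n j} head) tail) (≡.sym (∣∷∣-+ a l K L)))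

condL-conserves : ∀ {k} (I J K L : Vec Bool k) → condL I J K L ≡ true →
  ∣ I ∣ᵥ ℕ.+ ∣ J ∣ᵥ ≡ ∣ K ∣ᵥ ℕ.+ ∣ L ∣ᵥ
condL-conserves [] [] [] [] _ = ≡.refl
condL-conserves (i ∷ I) (j ∷ J) (a ∷ K) (l ∷ L) eq =
  ∣∣-conserved i j a l I J K L (∧-trueˡ eq)
    (condL-conserves I J K L (∧-trueʳ {not (i ∧ j)} (∧-trueʳ {b2n i ℕ.+ b2n j ≡ᵇ b2n a ℕ.+ b2n l} eq)))

condR-conserves : ∀ {k} (I J K L : Vec Bool k) → condR I J K L ≡ true →
  ∣ I ∣ᵥ ℕ.+ ∣ J ∣ᵥ ≡ ∣ K ∣ᵥ ℕ.+ ∣ L ∣ᵥ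
condR-conserves [] [] [] [] _ = ≡.refl
condR-conserves (i ∷ I) (j ∷ J) (a ∷ K) (l ∷ L) eq =
  ∣∣-conserved i j a l I J K L (∧-trueˡ eq)
    (condR-conserves I J K L
      (∧-trueʳ {not (i ∧ a ∧ not j ∧ not l)} (∧-trueʳ {b2n i ℕ.+ b2n j ≡ᵇ b2n a ℕ.+ b2n l} eq)))

-- Halving of integers and the exponent δ.

halfℤ-double : ∀ m → halfℤ (m ℤ.+ m) ≡ m
halfℤ-double (+ n)    = cong +_ (≡.sym (ℕ.n≡⌊n+n/2⌋ n))
halfℤ-double -[1+ n ] = cong -[1+_] (≡.sym (ℕ.n≡⌈n+n/2⌉ n))

⊖-conserved : ∀ i j k l → i ℕ.+ j ≡ k ℕ.+ l → l ⊖ i ≡ j ⊖ k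
⊖-conserved i j k l eq = begin
  l ⊖ i                     ≡⟨ ℤ.+-cancelˡ-⊖ k l i ⟨
  (k ℕ.+ l) ⊖ (k ℕ.+ i)     ≡⟨ cong₂ _⊖_ (≡.sym eq) (ℕ.+-comm k i) ⟩
  (i ℕ.+ j) ⊖ (i ℕ.+ k)     ≡⟨ ℤ.+-cancelˡ-⊖ i j k ⟩
  j ⊖ k                     ∎
  where open ≡.≡-Reasoning

-- Conservation makes j - k equal to l - i, so the integer to be halved is twice l - i and no
-- rounding occurs. Applied to the sizes of the tails it reads δ = |L| - |I|.
halfℤ-balance : ∀ i j k l → i ℕ.+ j ≡ k ℕ.+ l →
  halfℤ ((+ j ℤ.- + i) ℤ.+ (+ l ℤ.- + k)) ≡ l ⊖ i
halfℤ-balance i j k l eq = ≡.trans (cong halfℤ double) (halfℤ-double (l ⊖ i))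
  where
  open ≡.≡-Reasoning
  open CommutativeSemigroup ℤ.+-commutativeSemigroup using (interchange)
  double : (+ j ℤ.- + i) ℤ.+ (+ l ℤ.- + k) ≡ (l ⊖ i) ℤ.+ (l ⊖ i)
  double = begin
    (+ j ℤ.- + i) ℤ.+ (+ l ℤ.- + k)  ≡⟨ interchange (+ j) (ℤ.- + i) (+ l) (ℤ.- + k) ⟩
    (+ j ℤ.+ + l) ℤ.+ (ℤ.- + i ℤ.- + k)  ≡⟨ cong (ℤ._+ (ℤ.- + i ℤ.- + k)) (ℤ.+-comm (+ j) (+ l)) ⟩
    (+ l ℤ.+ + j) ℤ.+ (ℤ.- + i ℤ.- + k)  ≡⟨ interchange (+ l) (+ j) (ℤ.- + i) (ℤ.- + k) ⟩
    (+ l ℤ.- + i) ℤ.+ (+ j ℤ.- + k)  ≡⟨ cong₂ ℤ._+_ (ℤ.m-n≡m⊖n l i) (ℤ.m-n≡m⊖n j k) ⟩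
    (l ⊖ i) ℤ.+ (j ⊖ k)              ≡⟨ cong (ℤ._+_ (l ⊖ i)) (⊖-conserved i j k l eq) ⟨
    (l ⊖ i) ℤ.+ (l ⊖ i)              ∎

-- Admissible states of a single column.

okL : (i j a l : Bool) → Bool
okL i j a l = (b2n i ℕ.+ b2n j ≡ᵇ b2n a ℕ.+ b2n l) ∧ not (i ∧ j)

okR : (i j a l : Bool) → Bool
okR i j a l = (b2n i ℕ.+ b2n j ≡ᵇ b2n a ℕ.+ b2n l) ∧ not (i ∧ a ∧ not j ∧ not l)

bits : List Bool
bits = false ∷ true ∷ []

okˡ okʳ : (i₁ i₂ i₃ j₁ j₂ j₃ : Bool) → Vec Bool 3 → Bool
okˡ i₁ i₂ i₃ j₁ j₂ j₃ (k₁ ∷ k₂ ∷ k₃ ∷ []) = (okL k₃ k₂ j₃ j₂ ∧ okL i₃ k₁ k₃ j₁) ∧ okR i₂ i₁ k₂ k₁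
okʳ i₁ i₂ i₃ j₁ j₂ j₃ (l₁ ∷ l₂ ∷ l₃ ∷ []) = (okL i₃ i₂ l₃ l₂ ∧ okL l₃ i₁ j₃ l₁) ∧ okR l₂ l₁ j₂ j₁

-- For concrete boundary bits these lists evaluate, which turns a column sum into an explicit sum
-- over at most two admissible states.
supportˡ supportʳ : (i₁ i₂ i₃ j₁ j₂ j₃ : Bool) → List (Vec Bool 3)
supportˡ i₁ i₂ i₃ j₁ j₂ j₃ = filterᵇ (okˡ i₁ i₂ i₃ j₁ j₂ j₃) (allVecs 3)
supportʳ i₁ i₂ i₃ j₁ j₂ j₃ = filterᵇ (okʳ i₁ i₂ i₃ j₁ j₂ j₃) (allVecs 3)

∀Bool? : {P : Bool → Set} → (∀ b → Dec (P b)) → Dec (∀ b → P b)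
∀Bool? P? = map′ (λ { (f , t) → λ { false → f ; true → t } }) (λ p → p false , p true)
  (P? false ×-dec P? true)

Balanced : (i₁ i₂ i₃ j₁ j₂ j₃ : Bool) → Set
Balanced i₁ i₂ i₃ j₁ j₂ j₃ = b2n i₁ ℕ.+ b2n i₂ ℕ.+ b2n i₃ ≡ b2n j₁ ℕ.+ b2n j₂ ℕ.+ b2n j₃

Unsupported : (i₁ i₂ i₃ j₁ j₂ j₃ : Bool) → Set
Unsupported i₁ i₂ i₃ j₁ j₂ j₃ = supportˡ i₁ i₂ i₃ j₁ j₂ j₃ ≡ [] × supportʳ i₁ i₂ i₃ j₁ j₂ j₃ ≡ []

-- Every local condition conserves ones, so an unbalanced boundary admits no state on either side.
-- This is decided by evaluation at all 64 boundaries and leaves 20 balanced ones.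
balanced⊎unsupported : ∀ i₁ i₂ i₃ j₁ j₂ j₃ →
  Balanced i₁ i₂ i₃ j₁ j₂ j₃ ⊎ Unsupported i₁ i₂ i₃ j₁ j₂ j₃
balanced⊎unsupported = toWitness {a? =
  ∀Bool? λ i₁ → ∀Bool? λ i₂ → ∀Bool? λ i₃ → ∀Bool? λ j₁ → ∀Bool? λ j₂ → ∀Bool? λ j₃ →
    (_ ℕ.≟ _) ⊎-dec ((supportˡ i₁ i₂ i₃ j₁ j₂ j₃ ≟ []) ×-dec (supportʳ i₁ i₂ i₃ j₁ j₂ j₃ ≟ []))} tt
  where _≟_ = List.≡-dec (Vec.≡-dec Bool._≟_)

-- Finite sums over Boolean vectors.

module Summation {c ℓ} (𝓡 : CommutativeRing c ℓ) (t tinv : CommutativeRing.Carrier 𝓡) where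
  open CommutativeRing 𝓡
  open Weights 𝓡 t tinv
  open import Relation.Binary.Reasoning.Setoid setoid
  open CommutativeSemigroup +-commutativeSemigroup using (interchange)

  private variable
    A B : Set

  Σ-cong : ∀ (xs : List A) {f g : A → Carrier} → (∀ v → f v ≈ g v) → Σ xs f ≈ Σ xs g
  Σ-cong []       eq = refl
  Σ-cong (v ∷ xs) eq = +-cong (eq v) (Σ-cong xs eq)

  Σ-0 : ∀ (xs : List A) → Σ xs (λ _ → 0#) ≈ 0#
  Σ-0 []       = refl
  Σ-0 (_ ∷ xs) = trans (+-identityˡ _) (Σ-0 xs)

  Σ-+ : ∀ (xs : List A) f g → Σ xs (λ v → f v + g v) ≈ Σ xs f + Σ xs g
  Σ-+ []       f g = sym (+-identityˡ 0#)
  Σ-+ (v ∷ xs) f g = trans (+-congˡ (Σ-+ xs f g)) (interchange (f v) (g v) _ _)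

  Σ-*ˡ : ∀ (xs : List A) α f → Σ xs (λ v → α * f v) ≈ α * Σ xs f
  Σ-*ˡ []       α f = sym (zeroʳ α)
  Σ-*ˡ (v ∷ xs) α f = trans (+-congˡ (Σ-*ˡ xs α f)) (sym (distribˡ α (f v) _))

  Σ-swap : ∀ (xs : List A) (ys : List B) (f : A → B → Carrier) →
    Σ xs (λ u → Σ ys (f u)) ≈ Σ ys (λ v → Σ xs (λ u → f u v))
  Σ-swap []       ys f = sym (Σ-0 ys)
  Σ-swap (u ∷ xs) ys f = trans (+-congˡ (Σ-swap xs ys f)) (sym (Σ-+ ys (f u) _))

  Σ-++ : ∀ (xs ys : List A) f → Σ (xs ++ ys) f ≈ Σ xs f + Σ ys f
  Σ-++ []       ys f = sym (+-identityˡ _)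
  Σ-++ (v ∷ xs) ys f = trans (+-congˡ (Σ-++ xs ys f)) (sym (+-assoc (f v) _ _))

  Σ-map : ∀ (h : A → B) xs f → Σ (map h xs) f ≈ Σ xs (f ∘ h)
  Σ-map h []       f = refl
  Σ-map h (v ∷ xs) f = +-congˡ (Σ-map h xs f)

  Σ-filterᵇ : ∀ (p : A → Bool) xs f → Σ xs (λ v → if p v then f v else 0#) ≈ Σ (filterᵇ p xs) f
  Σ-filterᵇ p []       f = refl
  Σ-filterᵇ p (v ∷ xs) f with p v
  ... | true  = +-congˡ (Σ-filterᵇ p xs f)
  ... | false = trans (+-identityˡ _) (Σ-filterᵇ p xs f)

  Σ-allVecs-suc : ∀ k (f : Vec Bool (suc k) → Carrier) →
    Σ (allVecs (suc k)) f ≈ Σ bits (λ b → Σ (allVecs k) (λ v → f (b ∷ v)))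
  Σ-allVecs-suc k f = begin
    Σ (allVecs (suc k)) f
      ≈⟨ Σ-++ (map (false ∷_) (allVecs k)) _ f ⟩
    Σ (map (false ∷_) (allVecs k)) f + Σ (map (true ∷_) (allVecs k)) f
      ≈⟨ +-cong (Σ-map (false ∷_) (allVecs k) f) (Σ-map (true ∷_) (allVecs k) f) ⟩
    Σ (allVecs k) (f ∘ (false ∷_)) + Σ (allVecs k) (f ∘ (true ∷_))
      ≈⟨ +-congˡ (+-identityʳ _) ⟨
    Σ bits (λ b → Σ (allVecs k) (λ v → f (b ∷ v))) ∎

  Σ³-cong : ∀ k {f g : Vec Bool k → Vec Bool k → Vec Bool k → Carrier} →
    (∀ A B C → f A B C ≈ g A B C) → Σ³ k f ≈ Σ³ k g
  Σ³-cong k eq = Σ-cong V λ A → Σ-cong V λ B → Σ-cong V λ C → eq A B C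
    where V = allVecs k

  -- Brings the column coefficients α and β out of the sum over the other columns.
  Σ³-linear : ∀ k (w f g : Vec Bool k → Vec Bool k → Vec Bool k → Carrier) α β →
    Σ³ k (λ A B C → w A B C * (α * f A B C + β * g A B C))
      ≈ α * Σ³ k (λ A B C → w A B C * f A B C) + β * Σ³ k (λ A B C → w A B C * g A B C)
  Σ³-linear k w f g α β =
    trans (Σ-cong V λ A → trans (Σ-cong V λ B → trans (Σ-cong V λ C → factor (w A B C) (f A B C) (g A B C))
      linear) linear) linear
    where
    V = allVecs k
    linear : ∀ {f g : Vec Bool k → Carrier} →
      Σ V (λ v → α * f v + β * g v) ≈ α * Σ V f + β * Σ V g
    linear {f} {g} = trans (Σ-+ V _ _) (+-cong (Σ-*ˡ V α f) (Σ-*ˡ V β g))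
    open SemiringSolver commutativeSemiring
    factor : ∀ w f g → w * (α * f + β * g) ≈ α * (w * f) + β * (w * g)
    factor = solve 5 (λ α β w f g → w :* (α :* f :+ β :* g) := α :* (w :* f) :+ β :* (w :* g)) refl α β

  -- Exchanging sums moves the three bits of the first column innermost, so that this column is
  -- summed while the tails are held fixed.
  Σ³-suc : ∀ k (f : (A B C : Vec Bool (suc k)) → Carrier) (g : Vec Bool 3 → (A B C : Vec Bool k) → Carrier) →
    (∀ a b c A B C → f (a ∷ A) (b ∷ B) (c ∷ C) ≈ g (a ∷ b ∷ c ∷ []) A B C) →
    Σ³ (suc k) f ≈ Σ³ k (λ A B C → Σ (allVecs 3) (λ v → g v A B C))
  Σ³-suc k f g eq = begin
    Σ³ (suc k) f
      ≈⟨ (Σ-allVecs-suc′ _ (λ a A → Σ bits λ b → Σ V λ B → Σ bits λ c → Σ V λ C → G a b c A B C)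
            λ a A → trans (Σ-allVecs-suc k _) (Σ-cong bits λ b → Σ-cong V λ B →
            trans (Σ-allVecs-suc k (f (a ∷ A) (b ∷ B))) (Σ-cong bits λ c → Σ-cong V λ C → eq a b c A B C))) ⟩
    (Σ V λ A → Σ bits λ a → Σ bits λ b → Σ V λ B → Σ bits λ c → Σ V λ C → G a b c A B C)
      ≈⟨ (Σ-cong V λ A → trans
           (Σ-cong bits λ a → Σ-swap bits V λ b B → Σ bits λ c → Σ V λ C → G a b c A B C)
           (Σ-swap bits V λ a B → Σ bits λ b → Σ bits λ c → Σ V λ C → G a b c A B C)) ⟩
    (Σ V λ A → Σ V λ B → Σ bits λ a → Σ bits λ b → Σ bits λ c → Σ V λ C → G a b c A B C)
      ≈⟨ (Σ-cong V λ A → Σ-cong V λ B → trans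
           (Σ-cong bits λ a → trans
             (Σ-cong bits λ b → Σ-swap bits V λ c C → G a b c A B C)
             (Σ-swap bits V λ b C → Σ bits λ c → G a b c A B C))
           (Σ-swap bits V λ a C → Σ bits λ b → Σ bits λ c → G a b c A B C)) ⟩
    (Σ³ k λ A B C → Σ bits λ a → Σ bits λ b → Σ bits λ c → G a b c A B C)
      ≈⟨ (Σ³-cong k λ A B C → Σ-allVecs₃ (λ v → g v A B C)) ⟨
    Σ³ k (λ A B C → Σ (allVecs 3) (λ v → g v A B C)) ∎
    where
    V = allVecs k
    G = λ a b c → g (a ∷ b ∷ c ∷ [])
    Σ-allVecs-suc′ : ∀ (f : Vec Bool (suc k) → Carrier) (g : Bool → Vec Bool k → Carrier) →
      (∀ b v → f (b ∷ v) ≈ g b v) → Σ (allVecs (suc k)) f ≈ Σ V (λ v → Σ bits (λ b → g b v))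
    Σ-allVecs-suc′ f g eq = trans (Σ-allVecs-suc k f) (trans (Σ-swap bits V (λ b v → f (b ∷ v)))
      (Σ-cong V λ v → Σ-cong bits λ b → eq b v))
    Σ-allVecs₃ : ∀ f → Σ (allVecs 3) f ≈
      Σ bits (λ a → Σ bits (λ b → Σ bits (λ c → f (a ∷ b ∷ c ∷ []))))
    Σ-allVecs₃ f = trans (Σ-allVecs-suc 2 f) (Σ-cong bits λ a → Σ-allVecs-suc 1 (f ∘ (a ∷_)))


-- Setting: invertible `x` and `t`, with `z` = y/x.

Reciprocal : ∀ {c ℓ} (𝓡 : CommutativeRing c ℓ) (a b : CommutativeRing.Carrier 𝓡) → Set ℓ
Reciprocal 𝓡 a b = a * b ≈ 1#
  where open CommutativeRing 𝓡

module YangBaxter {c ℓ} (𝓡 : CommutativeRing c ℓ)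
  (x xinv y t tinv : CommutativeRing.Carrier 𝓡)
  (x-inverse : Reciprocal 𝓡 x xinv) (t-inverse : Reciprocal 𝓡 t tinv) where

  open CommutativeRing 𝓡
  open Weights 𝓡 t tinv
  open Summation 𝓡 t tinv
  open Ring ring using (x[y-z]≈xy-xz)
  open CommutativeSemigroup *-commutativeSemigroup using (x∙yz≈y∙xz; interchange)
  open import Relation.Binary.Reasoning.Setoid setoid
  open SemiringSolver commutativeSemiring using (solve; _:=_; _:+_; _:*_)

  z : Carrier
  z = y * xinv

  -- The polynomials `P` and their recursions.

  ^ₙ-+ : ∀ a m n → a ^ₙ (m ℕ.+ n) ≈ a ^ₙ m * a ^ₙ n
  ^ₙ-+ a zero    n = sym (*-identityˡ _)
  ^ₙ-+ a (suc m) n = trans (*-congˡ (^ₙ-+ a m n)) (sym (*-assoc _ _ _))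

  w+[a-w]≈a : ∀ w a → w + (a - w) ≈ a
  w+[a-w]≈a w a = trans (sym (+-assoc w a _)) (AbelianGroup.xyx⁻¹≈y +-abelianGroup w a)

  P : ℕ → ℕ → ℕ → Carrier
  P zero    e f = 1#
  P (suc n) e f = P n e f * (x * t ^ₙ (n ℕ.+ e) - y * t ^ₙ f)

  -- The definition splits off the factor with j = n. Here the factor with j = 0 is split off; the
  -- remaining ones are those of `P n` with e raised by one.
  P-suc : ∀ n e f → P (suc n) e f ≈ (x * t ^ₙ e - y * t ^ₙ f) * P n (suc e) f
  P-suc zero    e f = *-comm _ _
  P-suc (suc n) e f = begin
    P (suc n) e f * (x * t ^ₙ suc (n ℕ.+ e) - y * t ^ₙ f)
      ≡⟨ cong (λ m → P (suc n) e f * (x * t ^ₙ m - y * t ^ₙ f)) (ℕ.+-suc n e) ⟨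
    P (suc n) e f * (x * t ^ₙ (n ℕ.+ suc e) - y * t ^ₙ f)
      ≈⟨ *-congʳ (P-suc n e f) ⟩
    ((x * t ^ₙ e - y * t ^ₙ f) * P n (suc e) f) * (x * t ^ₙ (n ℕ.+ suc e) - y * t ^ₙ f)
      ≈⟨ *-assoc _ _ _ ⟩
    (x * t ^ₙ e - y * t ^ₙ f) * P (suc n) (suc e) f ∎

  -- Each of the n factors acquires one `t`.
  P-shift : ∀ n e f → P n (suc e) (suc f) ≈ t ^ₙ n * P n e f
  P-shift zero    e f = sym (*-identityˡ 1#)
  P-shift (suc n) e f = begin
    P n (suc e) (suc f) * (x * t ^ₙ (n ℕ.+ suc e) - y * (t * t ^ₙ f))
      ≡⟨ cong (λ m → P n (suc e) (suc f) * (x * t ^ₙ m - y * (t * t ^ₙ f))) (ℕ.+-suc n e) ⟩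
    P n (suc e) (suc f) * (x * (t * t ^ₙ (n ℕ.+ e)) - y * (t * t ^ₙ f))
      ≈⟨ *-cong (P-shift n e f) (+-cong (x∙yz≈y∙xz _ _ _) (-‿cong (x∙yz≈y∙xz _ _ _))) ⟩
    (t ^ₙ n * P n e f) * (t * (x * t ^ₙ (n ℕ.+ e)) - t * (y * t ^ₙ f))
      ≈⟨ *-congˡ (x[y-z]≈xy-xz t _ _) ⟨
    (t ^ₙ n * P n e f) * (t * (x * t ^ₙ (n ℕ.+ e) - y * t ^ₙ f))
      ≈⟨ solve 4 (λ s p t d → (s :* p) :* (t :* d) := (t :* s) :* (p :* d)) refl _ _ _ _ ⟩
    t ^ₙ suc n * P (suc n) e f ∎

  -- Write u = x t^e and v = y t^f. The hypothesis says w = v/u without a division; in a column, u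
  -- is the parameter of the weight L_x and w that of R.
  module _ {e f w} (uw≈v : (x * t ^ₙ e) * w ≈ y * t ^ₙ f) where

    factor-root : ∀ n → x * t ^ₙ (n ℕ.+ e) - y * t ^ₙ f ≈ (x * t ^ₙ e) * (t ^ₙ n - w)
    factor-root n = begin
      x * t ^ₙ (n ℕ.+ e) - y * t ^ₙ f
        ≈⟨ +-cong (*-congˡ (^ₙ-+ t n e)) (-‿cong (sym uw≈v)) ⟩
      x * (t ^ₙ n * t ^ₙ e) - (x * t ^ₙ e) * w
        ≈⟨ +-congʳ (solve 3 (λ x a b → x :* (a :* b) := (x :* b) :* a) refl _ _ _) ⟩
      (x * t ^ₙ e) * t ^ₙ n - (x * t ^ₙ e) * w
        ≈⟨ x[y-z]≈xy-xz _ _ _ ⟨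
      (x * t ^ₙ e) * (t ^ₙ n - w) ∎

    -- By `factor-root` at 0, u (1 - w) is the factor with j = 0 of `P (suc n) e f`.
    P-raise : ∀ n → (x * t ^ₙ e) * ((1# - w) * P n (suc e) f) ≈ P (suc n) e f
    P-raise n = begin
      (x * t ^ₙ e) * ((1# - w) * P n (suc e) f)  ≈⟨ *-assoc _ _ _ ⟨
      ((x * t ^ₙ e) * (1# - w)) * P n (suc e) f  ≈⟨ *-congʳ (factor-root 0) ⟨
      (x * t ^ₙ e - y * t ^ₙ f) * P n (suc e) f  ≈⟨ P-suc n e f ⟨
      P (suc n) e f ∎

    -- After multiplication by u both sides equal `P (suc n) e f`, with its first or its last factor
    -- split off. The induction on n avoids cancelling u.
    P-telescope : ∀ n → (1# - w) * P n (suc e) f ≈ (t ^ₙ n - w) * P n e f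
    P-telescope zero    = refl
    P-telescope (suc n) = begin
      (1# - w) * (P n (suc e) f * (x * t ^ₙ (n ℕ.+ suc e) - y * t ^ₙ f))
        ≡⟨ cong (λ m → (1# - w) * (P n (suc e) f * (x * t ^ₙ m - y * t ^ₙ f))) (ℕ.+-suc n e) ⟩
      (1# - w) * (P n (suc e) f * (x * t ^ₙ (suc n ℕ.+ e) - y * t ^ₙ f))
        ≈⟨ *-assoc _ _ _ ⟨
      ((1# - w) * P n (suc e) f) * (x * t ^ₙ (suc n ℕ.+ e) - y * t ^ₙ f)
        ≈⟨ *-cong (P-telescope n) (factor-root (suc n)) ⟩
      ((t ^ₙ n - w) * P n e f) * ((x * t ^ₙ e) * (t ^ₙ suc n - w))
        ≈⟨ solve 4 (λ d p u d′ → (d :* p) :* (u :* d′) := d′ :* (p :* (u :* d))) refl _ _ _ _ ⟩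
      (t ^ₙ suc n - w) * (P n e f * ((x * t ^ₙ e) * (t ^ₙ n - w)))
        ≈⟨ *-congˡ (*-congˡ (factor-root n)) ⟨
      (t ^ₙ suc n - w) * P (suc n) e f ∎

    -- Merges the two states k₁ = 0 and k₁ = 1 of a left column, of R-weight w and 1 - w, into one
    -- multiple of `P n e f`.
    P-split : ∀ n → w * P n e f + (1# - w) * P n (suc e) f ≈ t ^ₙ n * P n e f
    P-split n = begin
      w * P n e f + (1# - w) * P n (suc e) f  ≈⟨ +-congˡ (P-telescope n) ⟩
      w * P n e f + (t ^ₙ n - w) * P n e f    ≈⟨ distribʳ _ _ _ ⟨
      (w + (t ^ₙ n - w)) * P n e f            ≈⟨ *-congʳ (w+[a-w]≈a w _) ⟩
      t ^ₙ n * P n e f                        ∎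

    P-shift-uw : ∀ n → (x * t ^ₙ e) * (w * P n (suc e) (suc f)) ≈ (y * t ^ₙ f * t ^ₙ n) * P n e f
    P-shift-uw n = begin
      (x * t ^ₙ e) * (w * P n (suc e) (suc f))  ≈⟨ *-assoc _ _ _ ⟨
      ((x * t ^ₙ e) * w) * P n (suc e) (suc f)  ≈⟨ *-cong uw≈v (P-shift n e f) ⟩
      (y * t ^ₙ f) * (t ^ₙ n * P n e f)         ≈⟨ *-assoc _ _ _ ⟨
      (y * t ^ₙ f * t ^ₙ n) * P n e f           ∎

    -- Split u t^n as u w + u (t^n - w): the first term is v, the second is the last factor of
    -- `P (suc n) e f`.
    P-shift-u : ∀ n → (x * t ^ₙ e) * P n (suc e) (suc f) ≈ y * t ^ₙ f * P n e f + P (suc n) e f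
    P-shift-u n = begin
      (x * t ^ₙ e) * P n (suc e) (suc f)
        ≈⟨ *-congˡ (P-shift n e f) ⟩
      (x * t ^ₙ e) * (t ^ₙ n * P n e f)
        ≈⟨ *-assoc _ _ _ ⟨
      ((x * t ^ₙ e) * t ^ₙ n) * P n e f
        ≈⟨ *-congʳ (*-congˡ (w+[a-w]≈a w (t ^ₙ n))) ⟨
      ((x * t ^ₙ e) * (w + (t ^ₙ n - w))) * P n e f
        ≈⟨ solve 4 (λ u w d p → (u :* (w :+ d)) :* p := (u :* w) :* p :+ p :* (u :* d)) refl _ _ _ _ ⟩
      ((x * t ^ₙ e) * w) * P n e f + P n e f * ((x * t ^ₙ e) * (t ^ₙ n - w))
        ≈⟨ +-cong (*-congʳ uw≈v) (*-congˡ (sym (factor-root n))) ⟩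
      y * t ^ₙ f * P n e f + P (suc n) e f ∎

  -- Weights as conditions with lists of factors.

  -- The product ends in `p`, so that no unit is left over when a value of `P` is multiplied on.
  times : List Carrier → Carrier → Carrier
  times xs p = foldr _*_ p xs

  times-* : ∀ xs p → times xs 1# * p ≈ times xs p
  times-* []       p = *-identityˡ p
  times-* (a ∷ xs) p = trans (*-assoc a _ p) (*-congˡ (times-* xs p))

  times-++ : ∀ xs ys → times xs 1# * times ys 1# ≈ times (xs ++ ys) 1#
  times-++ xs ys = trans (times-* xs _) (reflexive (≡.sym (List.foldr-++ _*_ 1# xs ys)))

  times-replicate : ∀ n a → times (replicate n a) 1# ≡ a ^ₙ n
  times-replicate zero    a = ≡.refl
  times-replicate (suc n) a = cong (a *_) (times-replicate n a)

  gated : Bool → List Carrier → Carrier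
  gated b xs = if b then times xs 1# else 0#

  gated-++ : ∀ b c xs ys → gated b xs * gated c ys ≈ gated (b ∧ c) (xs ++ ys)
  gated-++ true  true  xs ys = times-++ xs ys
  gated-++ true  false xs ys = zeroʳ _
  gated-++ false c     xs ys = zeroˡ _

  gated-* : ∀ b xs p → gated b xs * p ≈ (if b then times xs p else 0#)
  gated-* true  xs p = times-* xs p
  gated-* false xs p = zeroˡ p

  -- Here `c` is the condition on the tails. The head factor has to be known only where `c` holds,
  -- which makes conservation in the tails available for rewriting its exponent.
  gated-∧ : ∀ a b c {h q} xs → (c ≡ true → h ≈ times xs 1#) →
    (if a ∧ b ∧ c then h * q else 0#) ≈ gated (a ∧ b) xs * (if c then q else 0#)
  gated-∧ true  true  true  xs eq = *-congʳ (eq ≡.refl)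
  gated-∧ true  true  false xs eq = sym (zeroʳ _)
  gated-∧ true  false c     xs eq = sym (zeroˡ _)
  gated-∧ false b     c     xs eq = sym (zeroˡ _)

  -- A local weight is a 0/1 condition times a list of factors; with lists the trivial
  -- factors disappear by computation, which leaves few distinct shapes of column sums.
  factorsL : Carrier → Bool → List Carrier
  factorsL s l = replicate (b2n l) s

  factorsR : Carrier → (i j a l : Bool) → List Carrier
  factorsR w i j a l =
    replicate (b2n a) w ++ replicate (ℤ⁺ (halfℤ ((b2z j ℤ.- b2z i) ℤ.+ (b2z l ℤ.- b2z a)))) (1# - w)

  -- Splitting the first column off a single weight.

  Lw-∷ : ∀ s s′ {k} i j a l (I J K L : Vec Bool k) →
    (condL I J K L ≡ true → s * t ^ₙ (∣ I ∣ᵥ ℕ.+ ∣ J ∣ᵥ) ≡ s′) →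
    Lw s (i ∷ I) (j ∷ J) (a ∷ K) (l ∷ L) ≈ gated (okL i j a l) (factorsL s′ l) * Lw s I J K L
  Lw-∷ s s′ i j a l I J K L eq =
    gated-∧ (b2n i ℕ.+ b2n j ≡ᵇ b2n a ℕ.+ b2n l) (not (i ∧ j)) (condL I J K L) (factorsL s′ l) (head l)
    where
    head : ∀ l → condL I J K L ≡ true →
      (if l then s * t ^ₙ (∣ I ∣ᵥ ℕ.+ ∣ J ∣ᵥ) else 1#) ≈ times (factorsL s′ l) 1#
    head false _  = refl
    head true  ok = trans (reflexive (eq ok)) (sym (*-identityʳ s′))

  Rw-∷ : ∀ w {k} i j a l (I J K L : Vec Bool k) →
    (condR I J K L ≡ true → z * tpow (ℤ.- halfℤ (twoδ I J K L)) ≡ w) →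
    Rw z (i ∷ I) (j ∷ J) (a ∷ K) (l ∷ L) ≈ gated (okR i j a l) (factorsR w i j a l) * Rw z I J K L
  Rw-∷ w i j a l I J K L eq =
    gated-∧ (b2n i ℕ.+ b2n j ≡ᵇ b2n a ℕ.+ b2n l) (not (i ∧ a ∧ not j ∧ not l)) (condR I J K L)
      (factorsR w i j a l) head
    where
    e = ℤ⁺ (halfℤ ((b2z j ℤ.- b2z i) ℤ.+ (b2z l ℤ.- b2z a)))
    w′ = z * tpow (ℤ.- halfℤ (twoδ I J K L))
    head : condR I J K L ≡ true → w′ ^ₙ b2n a * (1# - w′) ^ₙ e ≈ times (factorsR w i j a l) 1#
    head ok = begin
      w′ ^ₙ b2n a * (1# - w′) ^ₙ e
        ≡⟨ cong (λ w → w ^ₙ b2n a * (1# - w) ^ₙ e) (eq ok) ⟩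
      w ^ₙ b2n a * (1# - w) ^ₙ e
        ≡⟨ cong₂ _*_ (times-replicate (b2n a) w) (times-replicate e (1# - w)) ⟨
      times (replicate (b2n a) w) 1# * times (replicate e (1# - w)) 1#
        ≈⟨ times-++ (replicate (b2n a) w) _ ⟩
      times (factorsR w i j a l) 1# ∎

  -- The relation between the parameters of a column.

  -- The factor `t ^ₙ n` clears a negative exponent; one `t` at a time is removed until m or n is
  -- zero.
  tpow-⊖ : ∀ m n → tpow (m ⊖ n) * t ^ₙ n ≈ t ^ₙ m
  tpow-⊖ m       zero    = *-identityʳ _
  -- `zero ⊖ suc n` evaluates to `-[1+ n ]`, so `tpow` gives a power of `tinv`.
  tpow-⊖ zero    (suc n) = cancel (suc n)
    where
    cancel : ∀ n → tinv ^ₙ n * t ^ₙ n ≈ 1#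
    cancel zero    = *-identityˡ 1#
    cancel (suc n) = begin
      (tinv * tinv ^ₙ n) * (t * t ^ₙ n)  ≈⟨ interchange _ _ _ _ ⟩
      (tinv * t) * (tinv ^ₙ n * t ^ₙ n)  ≈⟨ *-cong (trans (*-comm tinv t) t-inverse) (cancel n) ⟩
      1# * 1#                            ≈⟨ *-identityˡ 1# ⟩
      1#                                 ∎
  tpow-⊖ (suc m) (suc n) = begin
    tpow (suc m ⊖ suc n) * (t * t ^ₙ n)  ≡⟨ cong (λ d → tpow d * (t * t ^ₙ n)) (ℤ.[1+m]⊖[1+n]≡m⊖n m n) ⟩
    tpow (m ⊖ n) * (t * t ^ₙ n)          ≈⟨ x∙yz≈y∙xz _ _ _ ⟩
    t * (tpow (m ⊖ n) * t ^ₙ n)          ≈⟨ *-congˡ (tpow-⊖ m n) ⟩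
    t * t ^ₙ m                           ∎

  -- The product of the Lₓ- and R-parameters of a column does not depend on the
  -- summation variable b = |K₁| or |L₁|.
  uw≈v : ∀ a b c → (x * t ^ₙ (c ℕ.+ b)) * (z * tpow (a ⊖ b)) ≈ y * t ^ₙ (a ℕ.+ c)
  uw≈v a b c = begin
    (x * t ^ₙ (c ℕ.+ b)) * ((y * xinv) * tpow (a ⊖ b))
      ≈⟨ *-congʳ (*-congˡ (^ₙ-+ t c b)) ⟩
    (x * (t ^ₙ c * t ^ₙ b)) * ((y * xinv) * tpow (a ⊖ b))
      ≈⟨ solve 6 (λ x c b y x′ d → (x :* (c :* b)) :* ((y :* x′) :* d) :=
                                   (x :* x′) :* (y :* ((d :* b) :* c))) refl _ _ _ _ _ _ ⟩
    (x * xinv) * (y * ((tpow (a ⊖ b) * t ^ₙ b) * t ^ₙ c))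
      ≈⟨ *-cong x-inverse (*-congˡ (*-congʳ (tpow-⊖ a b))) ⟩
    1# * (y * (t ^ₙ a * t ^ₙ c))
      ≈⟨ *-identityˡ _ ⟩
    y * (t ^ₙ a * t ^ₙ c)
      ≈⟨ *-congˡ (^ₙ-+ t a c) ⟨
    y * t ^ₙ (a ℕ.+ c) ∎

  -- Column sums and their common coefficients.

  -- On the left the L_y-exponent of the first column is |J₂| + |J₃|, on the right it is
  -- |I₂| + |I₃|: each side uses the f or h that belongs to P on the other side.
  module Column (n : ℕ) (i₁ i₂ i₃ j₁ j₂ j₃ : Bool) (f h : ℕ) where

    termˡ termʳ : ℕ → Carrier → Vec Bool 3 → Carrier
    termˡ e w (k₁ ∷ k₂ ∷ k₃ ∷ []) =
      times ((factorsL (y * t ^ₙ h) j₂ ++ factorsL (x * t ^ₙ e) j₁) ++ factorsR w i₂ i₁ k₂ k₁)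
        (P n ((b2n i₃ ℕ.+ b2n k₁) ℕ.+ e) ((b2n i₂ ℕ.+ b2n i₃) ℕ.+ f))
    termʳ e w (l₁ ∷ l₂ ∷ l₃ ∷ []) =
      times ((factorsL (y * t ^ₙ f) l₂ ++ factorsL (x * t ^ₙ e) l₁) ++ factorsR w l₂ l₁ j₂ j₁)
        (P n ((b2n j₃ ℕ.+ b2n l₁) ℕ.+ e) ((b2n j₂ ℕ.+ b2n j₃) ℕ.+ h))

    -- The coefficients are fixed before e and w, which carry |K₁| or |L₁|. Hence they can leave the
    -- sum over the tails.
    Columnˡ Columnʳ : (α β : Carrier) → Set (c ⊔ ℓ)
    Columnˡ α β = ∀ {e w} → (x * t ^ₙ e) * w ≈ y * t ^ₙ f →
      Σ (supportˡ i₁ i₂ i₃ j₁ j₂ j₃) (termˡ e w) ≈ α * P n e f + β * P (suc n) e f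
    Columnʳ α β = ∀ {e w} → (x * t ^ₙ e) * w ≈ y * t ^ₙ h →
      Σ (supportʳ i₁ i₂ i₃ j₁ j₂ j₃) (termʳ e w) ≈ α * P n e h + β * P (suc n) e h

  -- One claim for each shape of column sum. The trailing `+ 0#` is the end of a sum evaluated over
  -- its support, so the claims fit the columns by computation.
  module Claims (n : ℕ) where

    0-claim : ∀ {p q} → 0# ≈ 0# * p + 0# * q
    0-claim = sym (trans (+-cong (zeroˡ _) (zeroˡ _)) (+-identityʳ 0#))

    scaled : ∀ {r α p q} → r ≈ α * p → r + 0# ≈ α * p + 0# * q
    scaled eq = +-cong eq (sym (zeroˡ _))

    raised : ∀ {r α p q} → r ≈ α * p + q → r + 0# ≈ α * p + 1# * q
    raised eq = trans (+-identityʳ _) (trans eq (+-congˡ (sym (*-identityˡ _))))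

    shift : ∀ {e f} → P n (suc e) (suc f) + 0# ≈ t ^ₙ n * P n e f + 0# * P (suc n) e f
    shift {e} {f} = scaled (P-shift n e f)

    s-shift : ∀ {e f} s → s * P n (suc e) (suc f) + 0# ≈ (s * t ^ₙ n) * P n e f + 0# * P (suc n) e f
    s-shift {e} {f} s = scaled (trans (*-congˡ (P-shift n e f)) (sym (*-assoc s _ _)))

    module _ {e f w} (hyp : (x * t ^ₙ e) * w ≈ y * t ^ₙ f) where
      u v : Carrier
      u = x * t ^ₙ e
      v = y * t ^ₙ f

      raise : u * ((1# - w) * P n (suc e) f) + 0# ≈ 0# * P n e f + 1# * P (suc n) e f
      raise = raised (trans (P-raise hyp n) (sym (trans (+-congʳ (zeroˡ _)) (+-identityˡ _))))

      s-raise : ∀ s → s * P n e f + (u * ((1# - w) * P n (suc e) f) + 0#) ≈ s * P n e f + 1# * P (suc n) e f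
      s-raise s = +-congˡ (trans (+-identityʳ _) (trans (P-raise hyp n) (sym (*-identityˡ _))))

      u-shift : u * P n (suc e) (suc f) + 0# ≈ v * P n e f + 1# * P (suc n) e f
      u-shift = raised (P-shift-u hyp n)

      uw-shift : u * (w * P n (suc e) (suc f)) + 0# ≈ (v * t ^ₙ n) * P n e f + 0# * P (suc n) e f
      uw-shift = scaled (P-shift-uw hyp n)

      s-uw-shift : ∀ s → s * (u * (w * P n (suc e) (suc f))) + 0# ≈
        (s * (v * t ^ₙ n)) * P n e f + 0# * P (suc n) e f
      s-uw-shift s = scaled (trans (*-congˡ (P-shift-uw hyp n)) (sym (*-assoc s _ _)))

      s-uw-shift′ : ∀ s → s * (u * (w * P n (suc e) (suc f))) + 0# ≈
        (v * (s * t ^ₙ n)) * P n e f + 0# * P (suc n) e f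
      s-uw-shift′ s = trans (s-uw-shift s) (+-congʳ (*-congʳ (x∙yz≈y∙xz _ _ _)))

      split : w * P n e f + ((1# - w) * P n (suc e) f + 0#) ≈ t ^ₙ n * P n e f + 0# * P (suc n) e f
      split = trans (sym (+-assoc _ _ _)) (scaled (P-split hyp n))

      s-split : ∀ s → s * (w * P n e f) + (s * ((1# - w) * P n (suc e) f) + 0#) ≈
        (s * t ^ₙ n) * P n e f + 0# * P (suc n) e f
      s-split s = trans (sym (+-assoc _ _ _)) (scaled (trans (sym (distribˡ s _ _))
        (trans (*-congˡ (P-split hyp n)) (sym (*-assoc s _ _)))))

  -- The coefficients are read off from the explicit column sums. Only the output j = (1, 0, 0) with
  -- a single one among the i's gives β = 1 and so brings in `P (suc n)`.
  column : ∀ n i₁ i₂ i₃ j₁ j₂ j₃ f h → let open Column n i₁ i₂ i₃ j₁ j₂ j₃ f h in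
    ∃₂ λ α β → Columnˡ α β × Columnʳ α β
  column n i₁ i₂ i₃ j₁ j₂ j₃ f h with balanced⊎unsupported i₁ i₂ i₃ j₁ j₂ j₃
  ... | inj₂ (emptyˡ , emptyʳ) = 0# , 0# ,
    (λ {e} {w} _ → trans (reflexive (cong (λ xs → Σ xs (termˡ e w)) emptyˡ)) 0-claim) ,
    (λ {e} {w} _ → trans (reflexive (cong (λ xs → Σ xs (termʳ e w)) emptyʳ)) 0-claim)
    where
    open Claims n
    open Column n i₁ i₂ i₃ j₁ j₂ j₃ f h
  ... | inj₁ balanced = cases i₁ i₂ i₃ j₁ j₂ j₃ balanced
    where
    open Claims n
    T′ = t ^ₙ n
    vᶠ = y * t ^ₙ f
    vʰ = y * t ^ₙ h
    cases : ∀ i₁ i₂ i₃ j₁ j₂ j₃ → Balanced i₁ i₂ i₃ j₁ j₂ j₃ →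
      let open Column n i₁ i₂ i₃ j₁ j₂ j₃ f h in ∃₂ λ α β → Columnˡ α β × Columnʳ α β
    cases false false false false false false _ = 1# , 0# ,
      (λ _ → scaled (sym (*-identityˡ _))) , (λ _ → scaled (sym (*-identityˡ _)))
    cases true  false false true  false false _ = 0# , 1# , raise , raise
    cases true  false false false true  false _ = vʰ * T′ , 0# , (λ hyp → s-split hyp vʰ) , uw-shift
    cases true  false false false false true  _ = T′ , 0# , split , (λ _ → shift)
    cases false true  false true  false false _ = vᶠ , 1# , u-shift , (λ hyp → s-raise hyp vᶠ)
    cases false true  false false true  false _ = vʰ * T′ , 0# , (λ _ → s-shift vʰ) , uw-shift
    cases false true  false false false true  _ = T′ , 0# , (λ _ → shift) , (λ _ → shift)
    cases false false true  true  false false _ = vᶠ , 1# , u-shift , (λ hyp → s-raise hyp vᶠ)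
    cases false false true  false true  false _ = vʰ * T′ , 0# , (λ _ → s-shift vʰ) , uw-shift
    cases false false true  false false true  _ = T′ , 0# , (λ _ → shift) , (λ _ → shift)
    -- One of the factors `vᶠ` and `vʰ` is the weight L_y, the other is u w. The two sides exchange
    -- these roles, so the left product is reordered to give the same α.
    cases true  true  false true  true  false _ = vᶠ * (vʰ * T′) , 0# ,
      (λ hyp → s-uw-shift′ hyp vʰ) , (λ hyp → s-uw-shift hyp vᶠ)
    cases true  true  false true  false true  _ = vᶠ * T′ , 0# , uw-shift , (λ _ → s-shift vᶠ)
    cases true  false true  true  true  false _ = vᶠ * (vʰ * T′) , 0# ,
      (λ hyp → s-uw-shift′ hyp vʰ) , (λ hyp → s-uw-shift hyp vᶠ)
    cases true  false true  true  false true  _ = vᶠ * T′ , 0# , uw-shift , (λ _ → s-shift vᶠ)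
    -- In the remaining balanced cases both supports are empty: a state would need two ones entering
    -- the same L-vertex or the excluded state of R.
    cases true  true  false false true  true  _ = 0# , 0# , (λ _ → 0-claim) , (λ _ → 0-claim)
    cases true  false true  false true  true  _ = 0# , 0# , (λ _ → 0-claim) , (λ _ → 0-claim)
    cases false true  true  true  true  false _ = 0# , 0# , (λ _ → 0-claim) , (λ _ → 0-claim)
    cases false true  true  true  false true  _ = 0# , 0# , (λ _ → 0-claim) , (λ _ → 0-claim)
    cases false true  true  false true  true  _ = 0# , 0# , (λ _ → 0-claim) , (λ _ → 0-claim)
    cases true  true  true  true  true  true  _ = 0# , 0# , (λ _ → 0-claim) , (λ _ → 0-claim)
    cases false true  true  false true  false ()
    cases true  false true  false true  false ()
    cases true  true  false false true  false ()
    cases true  true  true  true  true  false ()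
    cases true  true  true  false true  false ()
    cases true  true  true  true  false true  ()
    cases true  true  true  false false true  ()

  -- Splitting the first column off the triple products.

  Wˡ Wʳ : ∀ {k} (I₁ I₂ I₃ J₁ J₂ J₃ M₁ M₂ M₃ : Vec Bool k) → Carrier
  Wˡ I₁ I₂ I₃ J₁ J₂ J₃ K₁ K₂ K₃ = (Lw y K₃ K₂ J₃ J₂ * Lw x I₃ K₁ K₃ J₁) * Rw z I₂ I₁ K₂ K₁
  Wʳ I₁ I₂ I₃ J₁ J₂ J₃ L₁ L₂ L₃ = (Rw z L₂ L₁ J₂ J₁ * Lw x L₃ I₁ J₃ L₁) * Lw y I₃ I₂ L₃ L₂

  module _ (n : ℕ) {k} (I₁ I₂ I₃ J₁ J₂ J₃ : Vec Bool k) (i₁ i₂ i₃ j₁ j₂ j₃ : Bool) where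
    open Column n i₁ i₂ i₃ j₁ j₂ j₃ (∣ I₂ ∣ᵥ ℕ.+ ∣ I₃ ∣ᵥ) (∣ J₂ ∣ᵥ ℕ.+ ∣ J₃ ∣ᵥ)

    -- Conservation in the tails replaces |K₂| + |K₃| by |J₂| + |J₃| and reduces δ to |K₁| - |I₂|.
    -- The column factor then depends on the summed tails through |K₁| alone.
    Wˡ-∷ : ∀ k₁ k₂ k₃ K₁ K₂ K₃ →
      Wˡ (i₁ ∷ I₁) (i₂ ∷ I₂) (i₃ ∷ I₃) (j₁ ∷ J₁) (j₂ ∷ J₂) (j₃ ∷ J₃) (k₁ ∷ K₁) (k₂ ∷ K₂) (k₃ ∷ K₃)
        * P n (∣ i₃ ∷ I₃ ∣ᵥ ℕ.+ ∣ k₁ ∷ K₁ ∣ᵥ) (∣ i₂ ∷ I₂ ∣ᵥ ℕ.+ ∣ i₃ ∷ I₃ ∣ᵥ)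
      ≈ Wˡ I₁ I₂ I₃ J₁ J₂ J₃ K₁ K₂ K₃ *
        (let K = k₁ ∷ k₂ ∷ k₃ ∷ [] in
         if okˡ i₁ i₂ i₃ j₁ j₂ j₃ K
         then termˡ (∣ I₃ ∣ᵥ ℕ.+ ∣ K₁ ∣ᵥ) (z * tpow (∣ I₂ ∣ᵥ ⊖ ∣ K₁ ∣ᵥ)) K else 0#)
    Wˡ-∷ k₁ k₂ k₃ K₁ K₂ K₃ = begin
      _ ≈⟨ *-cong (*-cong (*-cong
             (Lw-∷ y sy k₃ k₂ j₃ j₂ K₃ K₂ J₃ J₂ λ ok → cong (λ m → y * t ^ₙ m)
               (≡.trans (condL-conserves K₃ K₂ J₃ J₂ ok) (ℕ.+-comm ∣ J₃ ∣ᵥ _)))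
             (Lw-∷ x sx i₃ k₁ k₃ j₁ I₃ K₁ K₃ J₁ λ _ → ≡.refl))
             (Rw-∷ w i₂ i₁ k₂ k₁ I₂ I₁ K₂ K₁ λ ok → cong (λ d → z * tpow d)
               (≡.trans (cong ℤ.-_ (halfℤ-balance ∣ I₂ ∣ᵥ ∣ I₁ ∣ᵥ ∣ K₂ ∣ᵥ ∣ K₁ ∣ᵥ
                   (condR-conserves I₂ I₁ K₂ K₁ ok)))
                 (≡.sym (ℤ.⊖-swap ∣ I₂ ∣ᵥ ∣ K₁ ∣ᵥ)))))
             (reflexive (cong₂ (P n) (∣∷∣-+ i₃ k₁ I₃ K₁) (∣∷∣-+ i₂ i₃ I₂ I₃))) ⟩
      _ ≈⟨ solve 7 (λ gy ty gx tx gr tr p → (((gy :* ty) :* (gx :* tx)) :* (gr :* tr)) :* p :=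
             ((ty :* tx) :* tr) :* (((gy :* gx) :* gr) :* p)) refl _ _ _ _ _ _ _ ⟩
      _ ≈⟨ *-congˡ (*-congʳ (trans (*-congʳ (gated-++ (okL k₃ k₂ j₃ j₂) _ (factorsL sy j₂) (factorsL sx j₁)))
             (gated-++ (okL k₃ k₂ j₃ j₂ ∧ okL i₃ k₁ k₃ j₁) _ (factorsL sy j₂ ++ factorsL sx j₁)
               (factorsR w i₂ i₁ k₂ k₁)))) ⟩
      _ ≈⟨ *-congˡ (gated-* (okˡ i₁ i₂ i₃ j₁ j₂ j₃ (k₁ ∷ k₂ ∷ k₃ ∷ []))
             ((factorsL sy j₂ ++ factorsL sx j₁) ++ factorsR w i₂ i₁ k₂ k₁) _) ⟩
      _ ∎
      where
      sy = y * t ^ₙ (∣ J₂ ∣ᵥ ℕ.+ ∣ J₃ ∣ᵥ)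
      sx = x * t ^ₙ (∣ I₃ ∣ᵥ ℕ.+ ∣ K₁ ∣ᵥ)
      w  = z * tpow (∣ I₂ ∣ᵥ ⊖ ∣ K₁ ∣ᵥ)

    Wʳ-∷ : ∀ l₁ l₂ l₃ L₁ L₂ L₃ →
      Wʳ (i₁ ∷ I₁) (i₂ ∷ I₂) (i₃ ∷ I₃) (j₁ ∷ J₁) (j₂ ∷ J₂) (j₃ ∷ J₃) (l₁ ∷ L₁) (l₂ ∷ L₂) (l₃ ∷ L₃)
        * P n (∣ j₃ ∷ J₃ ∣ᵥ ℕ.+ ∣ l₁ ∷ L₁ ∣ᵥ) (∣ j₂ ∷ J₂ ∣ᵥ ℕ.+ ∣ j₃ ∷ J₃ ∣ᵥ)
      ≈ Wʳ I₁ I₂ I₃ J₁ J₂ J₃ L₁ L₂ L₃ *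
        (let L = l₁ ∷ l₂ ∷ l₃ ∷ [] in
         if okʳ i₁ i₂ i₃ j₁ j₂ j₃ L
         then termʳ (∣ J₃ ∣ᵥ ℕ.+ ∣ L₁ ∣ᵥ) (z * tpow (∣ J₂ ∣ᵥ ⊖ ∣ L₁ ∣ᵥ)) L else 0#)
    Wʳ-∷ l₁ l₂ l₃ L₁ L₂ L₃ = begin
      _ ≈⟨ *-cong (*-cong (*-cong
             (Rw-∷ w l₂ l₁ j₂ j₁ L₂ L₁ J₂ J₁ λ ok → let conserved = condR-conserves L₂ L₁ J₂ J₁ ok in
               cong (λ d → z * tpow d) (≡.trans
                 -- `halfℤ-balance` gives δ = |J₁| - |L₂|. A second use of conservation turns this
                 -- into |L₁| - |J₂|, so that only |L₁| enters, as in the L_x-exponent.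
                 (cong ℤ.-_ (≡.trans (halfℤ-balance ∣ L₂ ∣ᵥ ∣ L₁ ∣ᵥ ∣ J₂ ∣ᵥ ∣ J₁ ∣ᵥ conserved)
                   (⊖-conserved ∣ L₂ ∣ᵥ ∣ L₁ ∣ᵥ ∣ J₂ ∣ᵥ ∣ J₁ ∣ᵥ conserved)))
                 (≡.sym (ℤ.⊖-swap ∣ J₂ ∣ᵥ ∣ L₁ ∣ᵥ))))
             (Lw-∷ x sx l₃ i₁ j₃ l₁ L₃ I₁ J₃ L₁ λ ok → cong (λ m → x * t ^ₙ m)
               (condL-conserves L₃ I₁ J₃ L₁ ok)))
             (Lw-∷ y sy i₃ i₂ l₃ l₂ I₃ I₂ L₃ L₂ λ _ → cong (λ m → y * t ^ₙ m) (ℕ.+-comm ∣ I₃ ∣ᵥ _)))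
             (reflexive (cong₂ (P n) (∣∷∣-+ j₃ l₁ J₃ L₁) (∣∷∣-+ j₂ j₃ J₂ J₃))) ⟩
      _ ≈⟨ solve 7 (λ gy ty gx tx gr tr p → (((gr :* tr) :* (gx :* tx)) :* (gy :* ty)) :* p :=
             ((tr :* tx) :* ty) :* (((gy :* gx) :* gr) :* p)) refl _ _ _ _ _ _ _ ⟩
      _ ≈⟨ *-congˡ (*-congʳ (trans (*-congʳ (gated-++ (okL i₃ i₂ l₃ l₂) _ (factorsL sy l₂) (factorsL sx l₁)))
             (gated-++ (okL i₃ i₂ l₃ l₂ ∧ okL l₃ i₁ j₃ l₁) _ (factorsL sy l₂ ++ factorsL sx l₁)
               (factorsR w l₂ l₁ j₂ j₁)))) ⟩
      _ ≈⟨ *-congˡ (gated-* (okʳ i₁ i₂ i₃ j₁ j₂ j₃ (l₁ ∷ l₂ ∷ l₃ ∷ []))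
             ((factorsL sy l₂ ++ factorsL sx l₁) ++ factorsR w l₂ l₁ j₂ j₁) _) ⟩
      _ ∎
      where
      sy = y * t ^ₙ (∣ I₂ ∣ᵥ ℕ.+ ∣ I₃ ∣ᵥ)
      sx = x * t ^ₙ (∣ J₃ ∣ᵥ ℕ.+ ∣ L₁ ∣ᵥ)
      w  = z * tpow (∣ J₂ ∣ᵥ ⊖ ∣ L₁ ∣ᵥ)

  -- Induction on the number of columns.

  Sˡ Sʳ : ℕ → ∀ {k} (I₁ I₂ I₃ J₁ J₂ J₃ : Vec Bool k) → Carrier
  Sˡ n {k} I₁ I₂ I₃ J₁ J₂ J₃ = Σ³ k λ K₁ K₂ K₃ →
    Wˡ I₁ I₂ I₃ J₁ J₂ J₃ K₁ K₂ K₃ * P n (∣ I₃ ∣ᵥ ℕ.+ ∣ K₁ ∣ᵥ) (∣ I₂ ∣ᵥ ℕ.+ ∣ I₃ ∣ᵥ)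
  Sʳ n {k} I₁ I₂ I₃ J₁ J₂ J₃ = Σ³ k λ L₁ L₂ L₃ →
    Wʳ I₁ I₂ I₃ J₁ J₂ J₃ L₁ L₂ L₃ * P n (∣ J₃ ∣ᵥ ℕ.+ ∣ L₁ ∣ᵥ) (∣ J₂ ∣ᵥ ℕ.+ ∣ J₃ ∣ᵥ)

  module _ (n : ℕ) {k} (I₁ I₂ I₃ J₁ J₂ J₃ : Vec Bool k) (i₁ i₂ i₃ j₁ j₂ j₃ : Bool) {α β : Carrier} where
    open Column n i₁ i₂ i₃ j₁ j₂ j₃ (∣ I₂ ∣ᵥ ℕ.+ ∣ I₃ ∣ᵥ) (∣ J₂ ∣ᵥ ℕ.+ ∣ J₃ ∣ᵥ)

    Sˡ-∷ : Columnˡ α β →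
      Sˡ n (i₁ ∷ I₁) (i₂ ∷ I₂) (i₃ ∷ I₃) (j₁ ∷ J₁) (j₂ ∷ J₂) (j₃ ∷ J₃)
        ≈ α * Sˡ n I₁ I₂ I₃ J₁ J₂ J₃ + β * Sˡ (suc n) I₁ I₂ I₃ J₁ J₂ J₃
    Sˡ-∷ columnˡ = begin
      _ ≈⟨ Σ³-suc k _ (λ b K₁ K₂ K₃ → W K₁ K₂ K₃ * gate K₁ b)
             (λ k₁ k₂ k₃ → Wˡ-∷ n I₁ I₂ I₃ J₁ J₂ J₃ i₁ i₂ i₃ j₁ j₂ j₃ k₁ k₂ k₃) ⟩
      _ ≈⟨ (Σ³-cong k λ K₁ K₂ K₃ → trans (Σ-*ˡ (allVecs 3) (W K₁ K₂ K₃) (gate K₁)) (*-congˡ (trans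
             (Σ-filterᵇ (okˡ i₁ i₂ i₃ j₁ j₂ j₃) (allVecs 3) (term K₁))
             -- The hypothesis of the column identity holds for each K₁ separately, with the same
             -- right-hand side.
             (columnˡ (uw≈v ∣ I₂ ∣ᵥ ∣ K₁ ∣ᵥ ∣ I₃ ∣ᵥ))))) ⟩
      _ ≈⟨ Σ³-linear k W _ _ α β ⟩
      _ ∎
      where
      W = Wˡ I₁ I₂ I₃ J₁ J₂ J₃
      term = λ K₁ → termˡ (∣ I₃ ∣ᵥ ℕ.+ ∣ K₁ ∣ᵥ) (z * tpow (∣ I₂ ∣ᵥ ⊖ ∣ K₁ ∣ᵥ))
      gate = λ K₁ b → if okˡ i₁ i₂ i₃ j₁ j₂ j₃ b then term K₁ b else 0#

    Sʳ-∷ : Columnʳ α β →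
      Sʳ n (i₁ ∷ I₁) (i₂ ∷ I₂) (i₃ ∷ I₃) (j₁ ∷ J₁) (j₂ ∷ J₂) (j₃ ∷ J₃)
        ≈ α * Sʳ n I₁ I₂ I₃ J₁ J₂ J₃ + β * Sʳ (suc n) I₁ I₂ I₃ J₁ J₂ J₃
    Sʳ-∷ columnʳ = begin
      _ ≈⟨ Σ³-suc k _ (λ b L₁ L₂ L₃ → W L₁ L₂ L₃ * gate L₁ b)
             (λ l₁ l₂ l₃ → Wʳ-∷ n I₁ I₂ I₃ J₁ J₂ J₃ i₁ i₂ i₃ j₁ j₂ j₃ l₁ l₂ l₃) ⟩
      _ ≈⟨ (Σ³-cong k λ L₁ L₂ L₃ → trans (Σ-*ˡ (allVecs 3) (W L₁ L₂ L₃) (gate L₁)) (*-congˡ (trans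
             (Σ-filterᵇ (okʳ i₁ i₂ i₃ j₁ j₂ j₃) (allVecs 3) (term L₁))
             (columnʳ (uw≈v ∣ J₂ ∣ᵥ ∣ L₁ ∣ᵥ ∣ J₃ ∣ᵥ))))) ⟩
      _ ≈⟨ Σ³-linear k W _ _ α β ⟩
      _ ∎
      where
      W = Wʳ I₁ I₂ I₃ J₁ J₂ J₃
      term = λ L₁ → termʳ (∣ J₃ ∣ᵥ ℕ.+ ∣ L₁ ∣ᵥ) (z * tpow (∣ J₂ ∣ᵥ ⊖ ∣ L₁ ∣ᵥ))
      gate = λ L₁ b → if okʳ i₁ i₂ i₃ j₁ j₂ j₃ b then term L₁ b else 0#

  Sˡ≈Sʳ : ∀ n {k} (I₁ I₂ I₃ J₁ J₂ J₃ : Vec Bool k) →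
    Sˡ n I₁ I₂ I₃ J₁ J₂ J₃ ≈ Sʳ n I₁ I₂ I₃ J₁ J₂ J₃
  -- Without columns each sum has one term, and both evaluate to the same expression in `P n 0 0`.
  Sˡ≈Sʳ n [] [] [] [] [] [] = refl
  Sˡ≈Sʳ n (i₁ ∷ I₁) (i₂ ∷ I₂) (i₃ ∷ I₃) (j₁ ∷ J₁) (j₂ ∷ J₂) (j₃ ∷ J₃)
    with α , β , columnˡ , columnʳ ← column n i₁ i₂ i₃ j₁ j₂ j₃
      (∣ I₂ ∣ᵥ ℕ.+ ∣ I₃ ∣ᵥ) (∣ J₂ ∣ᵥ ℕ.+ ∣ J₃ ∣ᵥ) = begin
    Sˡ n (i₁ ∷ I₁) (i₂ ∷ I₂) (i₃ ∷ I₃) (j₁ ∷ J₁) (j₂ ∷ J₂) (j₃ ∷ J₃)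
      ≈⟨ Sˡ-∷ n I₁ I₂ I₃ J₁ J₂ J₃ i₁ i₂ i₃ j₁ j₂ j₃ columnˡ ⟩
    α * Sˡ n I₁ I₂ I₃ J₁ J₂ J₃ + β * Sˡ (suc n) I₁ I₂ I₃ J₁ J₂ J₃
      ≈⟨ +-cong (*-congˡ (Sˡ≈Sʳ n I₁ I₂ I₃ J₁ J₂ J₃)) (*-congˡ (Sˡ≈Sʳ (suc n) I₁ I₂ I₃ J₁ J₂ J₃)) ⟩
    α * Sʳ n I₁ I₂ I₃ J₁ J₂ J₃ + β * Sʳ (suc n) I₁ I₂ I₃ J₁ J₂ J₃
      ≈⟨ Sʳ-∷ n I₁ I₂ I₃ J₁ J₂ J₃ i₁ i₂ i₃ j₁ j₂ j₃ columnʳ ⟨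
    Sʳ n (i₁ ∷ I₁) (i₂ ∷ I₂) (i₃ ∷ I₃) (j₁ ∷ J₁) (j₂ ∷ J₂) (j₃ ∷ J₃) ∎

  yang-baxter : ∀ k (I₁ I₂ I₃ J₁ J₂ J₃ : Vec Bool k) →
    Σ³ k (Wˡ I₁ I₂ I₃ J₁ J₂ J₃) ≈ Σ³ k (Wʳ I₁ I₂ I₃ J₁ J₂ J₃)
  yang-baxter k I₁ I₂ I₃ J₁ J₂ J₃ = begin
    -- `P 0` evaluates to `1#`, so only a factor one is inserted.
    Σ³ k (Wˡ I₁ I₂ I₃ J₁ J₂ J₃)  ≈⟨ (Σ³-cong k λ _ _ _ → *-identityʳ _) ⟨
    Sˡ 0 I₁ I₂ I₃ J₁ J₂ J₃       ≈⟨ Sˡ≈Sʳ 0 I₁ I₂ I₃ J₁ J₂ J₃ ⟩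
    Sʳ 0 I₁ I₂ I₃ J₁ J₂ J₃       ≈⟨ (Σ³-cong k λ _ _ _ → *-identityʳ _) ⟩
    Σ³ k (Wʳ I₁ I₂ I₃ J₁ J₂ J₃)  ∎

theorem4p1 : ∀ {c ℓ} (𝓡 : CommutativeRing c ℓ) →
    let open CommutativeRing 𝓡 in
    (x xinv y t tinv : Carrier) → x * xinv ≈ 1# → t * tinv ≈ 1# →
    let open Weights 𝓡 t tinv in
    (k : ℕ) → 1 ≤ k →
    (I₁ I₂ I₃ J₁ J₂ J₃ : Vec Bool k) →
    Σ³ k (λ K₁ K₂ K₃ → (Lw y K₃ K₂ J₃ J₂ * Lw x I₃ K₁ K₃ J₁) * Rw (y * xinv) I₂ I₁ K₂ K₁)
    ≈ Σ³ k (λ L₁ L₂ L₃ → (Rw (y * xinv) L₂ L₁ J₂ J₁ * Lw x L₃ I₁ J₃ L₁) * Lw y I₃ I₂ L₃ L₂)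
theorem4p1 𝓡 x xinv y t tinv x-inverse t-inverse k _ =
  YangBaxter.yang-baxter 𝓡 x xinv y t tinv x-inverse t-inverse k
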